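{- Let $G$ be a finite group and let $Q_n(G)$ denote the Dowling lattice. (i) If $n=0$ or $n=1$, then $Q_n(G)$ is isomorphic to the lattice induced by a covering, i.e. there are a finite set $U$ and a covering $\mathcal{C}$ of $U$ with $L(\mathcal{C})\cong Q_n(G)$. (ii) Let $\mathcal{C}$ be a covering of a finite set $U$ with $|U|=m$, such that there are no two distinct elements $u,v\in U$ with $\mathcal{C}(\{u\})=\mathcal{C}(\{v\})$ and $|\mathcal{C}(\{u\})|=1$. Suppose that $L(\mathcal{C})$ is uniform and $|L^{(2)}(\mathcal{C})|<\binom{m}{2}$, and let $k:=|\mathcal{E}|$. If $n=2$, $m=|G|+2$, and $k=1$, then $L(\mathcal{C})\cong Q_2(G)$.
   Context: A covering of a finite set $U$ (possibly empty) is a collection $\mathcal{C}\subseteq 2^U$ of subsets of $U$ whose union is $U$. For $H\subseteq U$, $\mathcal{C}(H):=\{C\in\mathcal{C} : C\cap H\neq\emptyset\}$. The matroid $M(\mathcal{C})$ is the transversal matroid of $\mathcal{C}$ on the ground set $U$: its independent sets are the partial transversals of $\mathcal{C}$, i.e. the sets $I\subseteq U$ for which there is an injective map $\varphi:I\to\mathcal{C}$ with $e\in\varphi(e)$ for all $e\in I$. $L(\mathcal{C})$ is the lattice of closed sets (flats) of $M(\mathcal{C})$ ordered by inclusion, and $L^{(\ell)}(\mathcal{C})$ is the set of its elements of height $\ell$. A ranked lattice is uniform if any two elements of equal rank are covered by the same number of elements. For $x\in U$ with $|\mathcal{C}(\{x\})|=2$, $E(\{x\}):=\{y\in U : \mathcal{C}(\{y\})\subseteq\mathcal{C}(\{x\})\}$,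 and $\mathcal{E}:=\{E(\{x\}) : x\in U,\ |\mathcal{C}(\{x\})|=2\}$. Dowling lattice $Q_n(G)$: let $N=\{1,\dots,n\}$. A partial $G$-partition of $N$ is data $(Z;(B_1,a_1),\dots,(B_t,a_t))$ where $Z\subseteq N$ (the zero block), $\{B_1,\dots,B_t\}$ is a partition of $N\setminus Z$ into nonempty blocks, and each $a_i:B_i\to G$ is a function. Two such data are identified if they have the same zero block and the same nonzero blocks, and on each nonzero block $B$ the two labelings $a,a'$ satisfy $a'(x)=g\,a(x)$ for all $x\in B$, for some $g\in G$ (depending on $B$). The elements of $Q_n(G)$ are the resulting equivalence classes. The order is: $[(Z;(B_1,a_1),\dots,(B_t,a_t))]\leq[(Z';(C_1,b_1),\dots,(C_r,b_r))]$ if $Z\subseteq Z'$, each $C_j$ is a union of blocks among $B_1,\dots,B_t$, and for every $B_i\subseteq C_j$ there is $g_i\in G$ with $b_j(x)=g_i\,a_i(x)$ for all $x\in B_i$. -}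

module Defs where

open import Algebra.Bundles using (Group)
import Algebra.Properties.Group as GroupProperties
open import Data.Bool.Properties using () renaming (_≟_ to _≟ᵇ_)
open import Data.Fin.Base using (Fin)
open import Data.Fin.Subset
  using (Subset; _∈_; _∉_; _⊆_; _∩_; _∪_; ⁅_⁆; ⊤; ⋃; ∣_∣; Nonempty)
open import Data.Fin.Subset.Properties
  using (nonempty?; _⊆?_; ⊆-poset; ⊆-antisym; ⊆-reflexive; x∈⁅x⁆; x∈⁅y⁆⇒x≡y)
open import Data.List.Base using (List; length; filter; map; deduplicate; allFin)
import Data.List.Membership.Propositional as List
open import Data.List.Relation.Unary.Unique.Propositional using (Unique)
import Data.List.Relation.Binary.Subset.DecPropositional as ListSubset
open import Data.Nat.Base using (ℕ; zero; suc; _≤_)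
open import Data.Nat.Properties using () renaming (_≟_ to _≟ⁿ_)
open import Data.Product.Base using (Σ; ∃; _×_; _,_; proj₁; proj₂)
open import Data.Vec.Base using (tabulate)
open import Data.Vec.Properties
  using (≡-dec; lookup⇒[]=; []=⇒lookup; lookup∘tabulate)
open import Data.Vec.Properties.WithK using ([]=-irrelevant)
open import Function.Bundles using (Inverse; _⇔_; mk⇔; Equivalence)
open import Function.Definitions using (Injective)
open import Level using (Level; _⊔_)
open import Relation.Binary.Bundles using (Setoid; Poset)
open import Relation.Binary.Core using (Rel)
open import Relation.Binary.Structures using (IsEquivalence; IsPartialOrder)
import Relation.Binary.Construct.On as On
open import Relation.Binary.Definitions using (DecidableEquality)
open import Relation.Binary.Morphism.Structures using (IsOrderIsomorphism)
import Relation.Binary.Properties.Poset as PosetProperties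
open import Relation.Binary.PropositionalEquality
  using (_≡_; refl; sym; trans; cong; subst; setoid)
open import Relation.Nullary using (¬_; does)
open import Relation.Nullary.Decidable using (dec-true; yes; no)
open import Relation.Unary using (Pred; Decidable)

private
  variable
    a b ℓ ℓ₁ ℓ₂ ℓ₃ ℓ₄ p : Level
    m n : ℕ

HasCard : Setoid a ℓ → ℕ → Set (a ⊔ ℓ)
HasCard S k = Inverse (setoid (Fin k)) S

-- The elements satisfying P, compared by the equality of S alone.
_∣∣_ : (S : Setoid a ℓ) → Pred (Setoid.Carrier S) p → Setoid (a ⊔ p) ℓ
S ∣∣ P = On.setoid {B = ∃ P} S proj₁

module _ (P : Poset a ℓ₁ ℓ₂) where
  open Poset P using (Carrier; module Eq)
  open PosetProperties P using (_<_)

  _⋖_ : Rel Carrier (a ⊔ ℓ₁ ⊔ ℓ₂)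
  x ⋖ y = x < y × (∀ z → ¬ (x < z × z < y))

  -- Chain k x : a chain x₀ < x₁ < … < x_k = x.
  data Chain : ℕ → Carrier → Set (a ⊔ ℓ₁ ⊔ ℓ₂) where
    start : ∀ x → Chain zero x
    step  : ∀ {k x y} → Chain k x → x < y → Chain (suc k) y

  HasHeight : Carrier → ℕ → Set (a ⊔ ℓ₁ ⊔ ℓ₂)
  HasHeight x k = Chain k x × (∀ j → Chain j x → j ≤ k)

  AtHeight : ℕ → Setoid (a ⊔ ℓ₁ ⊔ ℓ₂) ℓ₁
  AtHeight k = Eq.setoid ∣∣ λ x → HasHeight x k

  Covers : Carrier → Setoid (a ⊔ ℓ₁ ⊔ ℓ₂) ℓ₁
  Covers x = Eq.setoid ∣∣ λ y → x ⋖ y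

  -- In a ranked lattice the rank of an element is its height.
  Uniform : Set (a ⊔ ℓ₁ ⊔ ℓ₂)
  Uniform = ∀ x y r → HasHeight x r → HasHeight y r →
            ∃ λ k → HasCard (Covers x) k × HasCard (Covers y) k

-- An order isomorphism preserves all existing joins and meets, so between
-- lattices this is lattice isomorphism.
infix 4 _≅_
_≅_ : Poset a ℓ₁ ℓ₂ → Poset b ℓ₃ ℓ₄ → Set (a ⊔ b ⊔ ℓ₁ ⊔ ℓ₂ ⊔ ℓ₃ ⊔ ℓ₄)
P ≅ Q = ∃ (IsOrderIsomorphism P._≈_ Q._≈_ P._≤_ Q._≤_)
  where
  module P = Poset P
  module Q = Poset Q

_≟ˢ_ : DecidableEquality (Subset n)
_≟ˢ_ = ≡-dec _≟ᵇ_

Element : Subset n → Set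
Element {n} I = Σ (Fin n) (_∈ I)

⟦_⟧ : {P : Pred (Fin n) p} → Decidable P → Subset n
⟦ P? ⟧ = tabulate λ x → does (P? x)

∈⟦⟧⁺ : {P : Pred (Fin n) p} (P? : Decidable P) → ∀ {x} → P x → x ∈ ⟦ P? ⟧
∈⟦⟧⁺ P? {x} px = lookup⇒[]= x _
  (trans (lookup∘tabulate (λ y → does (P? y)) x) (dec-true (P? x) px))

∈⟦⟧⁻ : {P : Pred (Fin n) p} (P? : Decidable P) → ∀ {x} → x ∈ ⟦ P? ⟧ → P x
∈⟦⟧⁻ P? {x} x∈ with P? x
  | trans (sym (lookup∘tabulate (λ y → does (P? y)) x)) ([]=⇒lookup x∈)
... | yes px | _ = px
... | no _   | ()

module Matroid (Independent : Subset n → Set) where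

  HasRank : Subset n → ℕ → Set
  HasRank A r =
    (∃ λ I → I ⊆ A × Independent I × ∣ I ∣ ≡ r) ×
    (∀ I → I ⊆ A → Independent I → ∣ I ∣ ≤ r)

  _∈cl_ : Fin n → Subset n → Set
  x ∈cl A = ∃ λ r → HasRank A r × HasRank (A ∪ ⁅ x ⁆) r

  IsClosed : Subset n → Set
  IsClosed F = ∀ x → x ∈cl F → x ∈ F

-- A duplicate-free list, so that lengths of its filtered sublists are
-- cardinalities.
record Covering (m : ℕ) : Set where
  field
    members : List (Subset m)
    unique  : Unique members
    union   : ⋃ members ≡ ⊤

module _ (𝒞 : Covering m) where
  open Covering 𝒞

  -- 𝒞 ⟨ H ⟩ lists the members of 𝒞 meeting H.
  _⟨_⟩ : Subset m → List (Subset m)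
  _⟨_⟩ H = filter (λ C → nonempty? (C ∩ H)) members

  record PartialTransversal (I : Subset m) : Set where
    field
      φ         : Element I → Subset m
      φ-member  : ∀ e → φ e List.∈ members
      injective : Injective {A = Element I} (λ e f → proj₁ e ≡ proj₁ f) _≡_ φ
      e∈φe      : ∀ e → proj₁ e ∈ φ e

  open Matroid PartialTransversal using (IsClosed)

  L : Poset _ _ _
  L = On.poset {B = ∃ IsClosed} (⊆-poset m) proj₁

  private
    open ListSubset (_≟ˢ_ {m}) using () renaming (_⊆?_ to _⊆ˡ?_)

  E : Fin m → Subset m
  E x = ⟦ (λ y → (_⟨_⟩ ⁅ y ⁆) ⊆ˡ? (_⟨_⟩ ⁅ x ⁆)) ⟧

  ℰ : List (Subset m)
  ℰ = deduplicate _≟ˢ_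
        (map E (filter (λ x → length (_⟨_⟩ ⁅ x ⁆) ≟ⁿ 2) (allFin m)))

module Dowling (n : ℕ) {c ℓ} (G : Group c ℓ) where
  open Group G renaming (refl to ≈-refl; sym to ≈-sym; trans to ≈-trans)

  -- The blocks are indexed by Fin size, but _≃_ disregards the indexing.
  record PartialPartition : Set c where
    field
      Z        : Subset n
      size     : ℕ
      block    : Fin size → Subset n
      nonempty : ∀ i → Nonempty (block i)
      disjoint : ∀ {i j x} → x ∈ block i → x ∈ block j → i ≡ j
      covers   : ∀ x → x ∉ Z ⇔ ∃ λ i → x ∈ block i
      label    : ∀ i → Element (block i) → Carrier

  open PartialPartition

  Shift : (P Q : PartialPartition) → Fin (size P) → Fin (size Q) → Set (c ⊔ ℓ)
  Shift P Q i j = ∃ λ g → ∀ x (x∈B : x ∈ block P i) (x∈C : x ∈ block Q j) →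
    label Q j (x , x∈C) ≈ g ∙ label P i (x , x∈B)

  record _≃_ (P Q : PartialPartition) : Set (c ⊔ ℓ) where
    field
      Z≡      : Z P ≡ Z Q
      blocks⊆ : ∀ i → ∃ λ j → block P i ≡ block Q j
      blocks⊇ : ∀ j → ∃ λ i → block P i ≡ block Q j
      labels  : ∀ i j → block P i ≡ block Q j → Shift P Q i j

  -- union: every block of Q is the union of the blocks of P indexed by some S.
  record _≼_ (P Q : PartialPartition) : Set (c ⊔ ℓ) where
    field
      Z⊆     : Z P ⊆ Z Q
      union  : ∀ j → ∃ λ (S : Subset (size P)) →
               ∀ x → x ∈ block Q j ⇔ ∃ λ i → i ∈ S × x ∈ block P i
      labels : ∀ i j → block P i ⊆ block Q j → Shift P Q i j

  private
    module ≃ = _≃_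
    module ≼ = _≼_
    open Equivalence using (to; from)

    shift-refl : ∀ P i j → i ≡ j → Shift P P i j
    shift-refl P i .i refl = ε , λ x p q → ≈-trans
      (reflexive (cong (λ r → label P i (x , r)) ([]=-irrelevant q p)))
      (≈-sym (identityˡ _))

    shift-trans : ∀ P Q R i j k → block P i ⊆ block Q j →
                  Shift P Q i j → Shift Q R j k → Shift P R i k
    shift-trans P Q R i j k B⊆C (g , eq) (h , eq′) = h ∙ g , λ x p r →
      ≈-trans (eq′ x (B⊆C p) r)
        (≈-trans (∙-congˡ (eq x p (B⊆C p))) (≈-sym (assoc h g _)))

    shift-sym : ∀ P Q i j → Shift P Q i j → Shift Q P j i
    shift-sym P Q i j (g , eq) = g ⁻¹ , λ x q p → ≈-sym
      (≈-trans (∙-congˡ (eq x p q))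
        (GroupProperties.\\-leftDividesʳ G g (label P i (x , p))))

    block-injective : ∀ P {i j} → block P i ⊆ block P j → i ≡ j
    block-injective P {i} B⊆B = disjoint P (proj₂ (nonempty P i))
                                           (B⊆B (proj₂ (nonempty P i)))

    part : ∀ {P Q} → P ≼ Q → ∀ {j x} → x ∈ block Q j → ∃ λ i → x ∈ block P i
    part P≼Q {j} {x} x∈C =
      let i , _ , x∈B = to (proj₂ (≼.union P≼Q j) x) x∈C in i , x∈B

    inside : ∀ {P Q} → P ≼ Q → ∀ {i j x} →
             x ∈ block P i → x ∈ block Q j → block P i ⊆ block Q j
    inside {P} P≼Q {i} {j} {x} x∈B x∈C {y} y∈B =
      let S , eq       = ≼.union P≼Q j
          i′ , i′∈S , x∈B′ = to (eq x) x∈C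
      in from (eq y) (i , subst (_∈ S) (disjoint P x∈B′ x∈B) i′∈S , y∈B)

    ≃-refl : ∀ {P} → P ≃ P
    ≃-refl {P} = record
      { Z≡      = refl
      ; blocks⊆ = λ i → i , refl
      ; blocks⊇ = λ i → i , refl
      ; labels  = λ i j eq →
          shift-refl P i j (block-injective P (⊆-reflexive eq))
      }

    ≃-sym : ∀ {P Q} → P ≃ Q → Q ≃ P
    ≃-sym {P} {Q} e = record
      { Z≡      = sym (≃.Z≡ e)
      ; blocks⊆ = λ j → let i , eq = ≃.blocks⊇ e j in i , sym eq
      ; blocks⊇ = λ i → let j , eq = ≃.blocks⊆ e i in j , sym eq
      ; labels  = λ j i eq → shift-sym P Q i j (≃.labels e i j (sym eq))
      }

    ≃-trans : ∀ {P Q R} → P ≃ Q → Q ≃ R → P ≃ R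
    ≃-trans {P} {Q} {R} e f = record
      { Z≡      = trans (≃.Z≡ e) (≃.Z≡ f)
      ; blocks⊆ = λ i → let j , eq  = ≃.blocks⊆ e i
                            k , eq′ = ≃.blocks⊆ f j
                        in k , trans eq eq′
      ; blocks⊇ = λ k → let j , eq′ = ≃.blocks⊇ f k
                            i , eq  = ≃.blocks⊇ e j
                        in i , trans eq eq′
      ; labels  = λ i k eq″ →
          let j , eq = ≃.blocks⊆ e i
          in shift-trans P Q R i j k (⊆-reflexive eq)
               (≃.labels e i j eq) (≃.labels f j k (trans (sym eq) eq″))
      }

    ≼-reflexive : ∀ {P Q} → P ≃ Q → P ≼ Q
    ≼-reflexive {P} {Q} e = record
      { Z⊆     = ⊆-reflexive (≃.Z≡ e)
      ; union  = λ j → let i , eq = ≃.blocks⊇ e j in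
          ⁅ i ⁆ , λ x → mk⇔
            (λ x∈C → i , x∈⁅x⁆ i , subst (x ∈_) (sym eq) x∈C)
            (λ { (i′ , i′∈ , x∈B) → subst (x ∈_)
                 (trans (cong (block P) (x∈⁅y⁆⇒x≡y i i′∈)) eq) x∈B })
      ; labels = λ i j B⊆C →
          let j′ , eq = ≃.blocks⊆ e i
              x , x∈B = nonempty P i
              j′≡j    = disjoint Q (subst (x ∈_) eq x∈B) (B⊆C x∈B)
          in ≃.labels e i j (trans eq (cong (block Q) j′≡j))
      }

    ≼-trans : ∀ {P Q R} → P ≼ Q → Q ≼ R → P ≼ R
    ≼-trans {P} {Q} {R} u v = record
      { Z⊆     = λ z → ≼.Z⊆ v (≼.Z⊆ u z)
      ; union  = λ k →
          let B⊆D? = λ i → block P i ⊆? block R k in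
          ⟦ B⊆D? ⟧ , λ x → mk⇔
            (λ x∈D → let j , x∈C = part v x∈D
                         i , x∈B = part u x∈C
                     in i
                      , ∈⟦⟧⁺ B⊆D? (λ y∈B →
                          inside v x∈C x∈D (inside u x∈B x∈C y∈B))
                      , x∈B)
            (λ { (i , i∈S , x∈B) → ∈⟦⟧⁻ B⊆D? i∈S x∈B })
      ; labels = λ i k B⊆D →
          let x , x∈B = nonempty P i
              j , x∈C = part v (B⊆D x∈B)
              B⊆C     = λ {y} → inside u x∈B x∈C {y}
          in shift-trans P Q R i j k B⊆C (≼.labels u i j B⊆C)
               (≼.labels v j k (inside v x∈C (B⊆D x∈B)))
      }

    ≼-antisym : ∀ {P Q} → P ≼ Q → Q ≼ P → P ≃ Q
    ≼-antisym {P} {Q} u v = record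
      { Z≡      = ⊆-antisym (≼.Z⊆ u) (≼.Z⊆ v)
      ; blocks⊆ = λ i →
          let x , x∈B = nonempty P i
              j , x∈C = part v x∈B
          in j , ⊆-antisym (inside u x∈B x∈C) (inside v x∈C x∈B)
      ; blocks⊇ = λ j →
          let x , x∈C = nonempty Q j
              i , x∈B = part u x∈C
          in i , ⊆-antisym (inside u x∈B x∈C) (inside v x∈C x∈B)
      ; labels  = λ i j eq → ≼.labels u i j (⊆-reflexive eq)
      }

  isPartialOrder : IsPartialOrder _≃_ _≼_
  isPartialOrder = record
    { isPreorder = record
        { isEquivalence = record
            { refl = ≃-refl ; sym = ≃-sym ; trans = ≃-trans }
        ; reflexive     = ≼-reflexive
        ; trans         = ≼-trans
        }
    ; antisym = ≼-antisym
    }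

  poset : Poset c (c ⊔ ℓ) (c ⊔ ℓ)
  poset = record { isPartialOrder = isPartialOrder }

Q : ∀ (n : ℕ) {c ℓ} → Group c ℓ → Poset c (c ⊔ ℓ) (c ⊔ ℓ)
Q n G = Dowling.poset n G

{-# OPTIONS --safe #-}
-- Q₂(G) is a line with |G| + 2 points: a bottom, a top, and |G| + 2 pairwise
-- incomparable elements in between.  In part (ii) M(𝒞) is simple, so by Hall's
-- condition a dependent triple meets exactly two sets of 𝒞 and one of its
-- points lies in both; as k = 1, all dependent triples lie in the one member F
-- of ℰ.  If F had fewer than three points, all pairs would be flats of height
-- 2, against |L⁽²⁾| < C(m, 2).  A point y outside F has m − 1 covers {y, v},
-- whereas a point of F has at most m − 2, since F absorbs two of its
-- candidates; by uniformity F = U, and L(𝒞) is a line with m points.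
module Submission where

open import Defs
open import Algebra.Bundles using (Group)
import Algebra.Properties.Group as GroupProperties
open import Data.Empty using (⊥-elim)
open import Data.Fin.Base using (Fin; zero; suc; punchOut)
open import Data.Fin.Properties
  using (injective⇒≤; punchOut-injective; any?; suc-injective)
  renaming (_≟_ to _≟ᶠ_)
open import Data.Fin.Subset
open import Data.Fin.Subset.Properties
open import Data.List.Base
  using (List; []; _∷_; _++_; length; map; lookup; allFin; filter)
import Data.List.Membership.Propositional as List
open import Data.List.Membership.Propositional using (find; lose)
open import Data.List.Membership.Propositional.Properties
  using (∈-map⁺; ∈-map⁻; ∈-filter⁺; ∈-filter⁻; ∈-lookup; ∈-allFin; ∈-++⁻;
         ∈-deduplicate⁺; ∈-deduplicate⁻)
open import Data.List.Membership.Propositional.Properties.WithK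
  using (unique∧set⇒bag)
open import Data.List.Membership.Setoid.Properties using (index-injective)
open import Data.List.Properties using (length-map; length-++; length-tabulate)
open import Data.List.Relation.Binary.BagAndSetEquality
  using (_∼[_]_; set; ∼bag⇒↭)
open import Data.List.Relation.Binary.Permutation.Propositional.Properties
  using (↭-length)
import Data.List.Relation.Binary.Subset.DecPropositional as ListSubset
open import Data.List.Relation.Unary.All as All using (All; []; _∷_)
open import Data.List.Relation.Unary.AllPairs using ([]; _∷_)
open import Data.List.Relation.Unary.Any as Any using (Any; here; there; index)
open import Data.List.Relation.Unary.Unique.Propositional using (Unique)
import Data.List.Relation.Unary.Unique.Propositional.Properties as Unique
open import Data.Nat.Base using (ℕ; zero; suc; _+_; _≤_; _<_; z≤n; s≤s)
open import Data.Nat.Combinatorics using (_C_; nCk+nC[k+1]≡[n+1]C[k+1]; nC1≡n)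
open import Data.Nat.Properties
  using (≤-trans; ≤-reflexive; <⇒≱; ≤-<-trans; 1+n≰n; +-comm)
  renaming (_≟_ to _≟ⁿ_)
open import Data.Product.Base using (∃; ∃₂; _×_; _,_; proj₁; proj₂)
open import Data.Sum.Base as Sum using (_⊎_; inj₁; inj₂; [_,_]′)
open import Data.Vec.Base using ([]; _∷_; here; there)
open import Data.Vec.Properties.WithK using ([]=-irrelevant)
open import Function.Base using (_∘_; const; id)
open import Function.Bundles using (Inverse; mk⇔; Equivalence)
open import Level using (Level; _⊔_)
open import Relation.Binary.Bundles using (Poset; Setoid)
open import Relation.Binary.PropositionalEquality
  using (_≡_; _≢_; refl; sym; trans; cong; cong₂; subst; setoid;
         module ≡-Reasoning)
open import Relation.Nullary using (¬_; Dec; yes; no; contradiction)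
open import Relation.Nullary.Decidable using (¬?; _×-dec_)
open import Relation.Unary using (Decidable)

private
  variable
    a b ℓ₁ ℓ₂ ℓ₃ ℓ₄ : Level
    k m n w         : ℕ
    X Y             : Set

-- Finite cardinalities and posets of line shape.

module _ {a ℓ} {S : Setoid a ℓ} (card : HasCard S k) where
  open Setoid S using (_≈_) renaming (sym to ≈-sym; trans to ≈-trans)
  open Inverse card

  card-to-injective : ∀ {i j} → to i ≈ to j → i ≡ j
  card-to-injective eq = trans (sym (strictlyInverseʳ _))
    (trans (from-cong eq) (strictlyInverseʳ _))

  card-from-injective : ∀ {x y} → from x ≡ from y → x ≈ y
  card-from-injective eq = ≈-trans (≈-sym (strictlyInverseˡ _))
    (≈-trans (to-cong eq) (strictlyInverseˡ _))

-- With `k = 0` this is the two-element chain, which serves the case n = 1; `top≰bottom` keeps its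
-- two ends apart when there are no points. `exhaustive` gives one inequality at each end because
-- `minimum` and `maximum` supply the other.
record IsLine (k : ℕ) (P : Poset a ℓ₁ ℓ₂) : Set (a ⊔ ℓ₁ ⊔ ℓ₂) where
  open Poset P using (Carrier; _≈_) renaming (_≤_ to _⊴_)
  field
    bottom          : Carrier
    top             : Carrier
    point           : Fin k → Carrier
    minimum         : ∀ p → bottom ⊴ p
    maximum         : ∀ p → p ⊴ top
    top≰bottom      : ¬ top ⊴ bottom
    point≰bottom    : ∀ i → ¬ point i ⊴ bottom
    top≰point       : ∀ i → ¬ top ⊴ point i
    point-injective : ∀ i j → point i ⊴ point j → i ≡ j
    exhaustive      : ∀ p → p ⊴ bottom ⊎ top ⊴ p ⊎ ∃ λ i → point i ≈ p

-- The model line. `at` embeds it in any poset with `IsLine k`, and `shape` inverts `at` up to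
-- equality, so two lines can be compared through it.
data Shape (k : ℕ) : Set where
  bottom top : Shape k
  point      : Fin k → Shape k

data _⊑_ {k} : Shape k → Shape k → Set where
  bottom⊑     : ∀ {s} → bottom ⊑ s
  ⊑top        : ∀ {s} → s ⊑ top
  point⊑point : ∀ {i} → point i ⊑ point i

module Line {P : Poset a ℓ₁ ℓ₂} (line : IsLine k P) where
  open Poset P using (Carrier; _≈_; antisym; reflexive; module Eq)
    renaming (_≤_ to _⊴_)
  private module Ln = IsLine line

  at : Shape k → Carrier
  at bottom    = Ln.bottom
  at top       = Ln.top
  at (point i) = Ln.point i

  at-mono : ∀ s t → s ⊑ t → at s ⊴ at t
  at-mono _ _ bottom⊑     = Ln.minimum _
  at-mono _ _ ⊑top        = Ln.maximum _
  at-mono _ _ point⊑point = reflexive Eq.refl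

  at-cancel : ∀ s t → at s ⊴ at t → s ⊑ t
  at-cancel bottom    _         _  = bottom⊑
  at-cancel _         top       _  = ⊑top
  at-cancel top       bottom    le = contradiction le Ln.top≰bottom
  at-cancel top       (point i) le = contradiction le (Ln.top≰point i)
  at-cancel (point i) bottom    le = contradiction le (Ln.point≰bottom i)
  at-cancel (point i) (point j) le with refl ← Ln.point-injective i j le =
    point⊑point

  shape : ∀ p → ∃ λ s → at s ≈ p
  shape p with Ln.exhaustive p
  ... | inj₁ p⊴b               = bottom , antisym (Ln.minimum p) p⊴b
  ... | inj₂ (inj₁ t⊴p)        = top , antisym t⊴p (Ln.maximum p)
  ... | inj₂ (inj₂ (i , pᵢ≈p)) = point i , pᵢ≈p

-- Each element of `P` goes to the element of `Q` of the same shape; the order is preserved and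
-- reflected because `at` does both on each side.
lines-≅ : {P : Poset a ℓ₁ ℓ₂} {Q : Poset b ℓ₃ ℓ₄} →
          IsLine k P → IsLine k Q → P ≅ Q
lines-≅ {P = P} {Q = Q} lineP lineQ = f , record
  { isOrderMonomorphism = record
      { isOrderHomomorphism = record
          { cong = λ x≈y → Q.antisym (mono (P.reflexive x≈y))
                                     (mono (P.reflexive (P.Eq.sym x≈y)))
          ; mono = mono
          }
      ; injective = λ fx≈fy → P.antisym (cancel (Q.reflexive fx≈fy))
                                        (cancel (Q.reflexive (Q.Eq.sym fx≈fy)))
      ; cancel    = cancel
      }
  -- `shape` need not return `s` at an element equal to `at s`, so the two shapes are compared in
  -- both directions.
  ; surjective = λ q → let s , s≈q = Q.shape q in
      P.at s , λ {p} p≈s → let t , t≈p = P.shape p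
                               t≈s     = P.Eq.trans t≈p p≈s in
      Q.Eq.trans (Q.antisym
        (Q.at-mono t s (P.at-cancel t s (P.reflexive t≈s)))
        (Q.at-mono s t (P.at-cancel s t (P.reflexive (P.Eq.sym t≈s))))) s≈q
  }
  where
  module P where
    open Poset P public
    open Line lineP public
  module Q where
    open Poset Q public
    open Line lineQ public

  shapeOf : P.Carrier → Shape _
  shapeOf p = proj₁ (P.shape p)

  f : P.Carrier → Q.Carrier
  f p = Q.at (shapeOf p)

  mono : ∀ {x y} → x P.≤ y → f x Q.≤ f y
  mono {x} {y} x≤y = Q.at-mono (shapeOf x) (shapeOf y) (P.at-cancel _ _
    (P.trans (P.reflexive (proj₂ (P.shape x)))
      (P.trans x≤y (P.reflexive (P.Eq.sym (proj₂ (P.shape y)))))))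

  cancel : ∀ {x y} → f x Q.≤ f y → x P.≤ y
  cancel {x} {y} fx≤fy =
    P.trans (P.reflexive (P.Eq.sym (proj₂ (P.shape x))))
      (P.trans (P.at-mono (shapeOf x) (shapeOf y) (Q.at-cancel _ _ fx≤fy))
        (P.reflexive (proj₂ (P.shape y))))

-- Serves n = 0, where top and bottom coincide and `IsLine` fails.
singletons-≅ : {P : Poset a ℓ₁ ℓ₂} {Q : Poset b ℓ₃ ℓ₄} →
               Poset.Carrier P → Poset.Carrier Q →
               (∀ x y → Poset._≤_ P x y) → (∀ x y → Poset._≤_ Q x y) → P ≅ Q
singletons-≅ {P = P} {Q = Q} p q P-total Q-total = const q , record
  { isOrderMonomorphism = record
      { isOrderHomomorphism = record
          { cong = λ _ → Q.Eq.refl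
          ; mono = λ _ → Q-total _ _
          }
      ; injective = λ _ → P.antisym (P-total _ _) (P-total _ _)
      ; cancel    = λ _ → P-total _ _
      }
  ; surjective = λ r → p , λ _ → Q.antisym (Q-total _ _) (Q-total _ _)
  }
  where
  module P = Poset P
  module Q = Poset Q

-- Dowling lattices

module DowlingLattice {c ℓ} (G : Group c ℓ) (n : ℕ) where
  open Group G renaming (refl to ≈-refl; sym to ≈-sym; trans to ≈-trans)
  open Dowling n G
  open PartialPartition
  open Equivalence using (to; from)

  block⊆∉Z : ∀ P {i x} → x ∈ block P i → x ∉ Z P
  block⊆∉Z P x∈B = from (covers P _) (_ , x∈B)

  block⊆block : ∀ {P Q} → P ≼ Q → ∀ {i j x} →
                x ∈ block P i → x ∈ block Q j → block P i ⊆ block Q j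
  block⊆block {P} P≼Q {j = j} x∈B x∈B′ {y} y∈B
    with S , eq ← _≼_.union P≼Q j
    with i′ , i′∈S , x∈Bᵢ′ ← to (eq _) x∈B′
    with refl ← disjoint P x∈B x∈Bᵢ′ = from (eq y) (_ , i′∈S , y∈B)

  -- A one-point block has a single labelling up to left multiplication: the quotient of the two
  -- labels at that point is the multiplier. If `x` is missing from either block, the blocks share
  -- no point and `ε` is a dummy value.
  shift-singleton : ∀ P Q i j x →
    (∀ {y} → y ∈ block P i → y ≡ x) → Shift P Q i j
  shift-singleton P Q i j x only with x ∈? block P i | x ∈? block Q j
  ... | yes x∈B | yes x∈B′ =
    label Q j (x , x∈B′) // label P i (x , x∈B) ,
    λ y p q → helper y p q (only p)
    where
    helper : ∀ y (p : y ∈ block P i) (q : y ∈ block Q j) → y ≡ x →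
             label Q j (y , q) ≈
             (label Q j (x , x∈B′) // label P i (x , x∈B)) ∙ label P i (y , p)
    helper y p q refl
      rewrite []=-irrelevant p x∈B | []=-irrelevant q x∈B′ =
      ≈-sym (GroupProperties.//-rightDividesˡ G _ _)
  ... | no x∉B  | _        = ε , λ y p q →
    contradiction (subst (_∈ _) (only p) p) x∉B
  ... | yes _   | no x∉B′  = ε , λ y p q →
    contradiction (subst (_∈ _) (only p) q) x∉B′

  -- The bottom element. All labellings of a singleton are equivalent, so `ε` is an arbitrary
  -- choice.
  discrete : PartialPartition
  discrete = record
    { Z        = ⊥
    ; size     = n
    ; block    = ⁅_⁆
    ; nonempty = λ i → i , x∈⁅x⁆ i
    ; disjoint = λ p q → trans (sym (x∈⁅y⁆⇒x≡y _ p)) (x∈⁅y⁆⇒x≡y _ q)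
    ; covers   = λ x → mk⇔ (λ _ → x , x∈⁅x⁆ x) (λ _ → ∉⊥)
    ; label    = λ _ _ → ε
    }

  discrete≼ : ∀ P → discrete ≼ P
  discrete≼ P = record
    { Z⊆     = ⊥⊆
    -- Block i of `discrete` is the singleton of i, so the index set of a block is the block itself.
    ; union  = λ j → block P j , λ x → mk⇔
        (λ x∈B → x , x∈B , x∈⁅x⁆ x)
        (λ { (i , i∈B , x∈⁅i⁆) → subst (_∈ _) (sym (x∈⁅y⁆⇒x≡y i x∈⁅i⁆)) i∈B })
    ; labels = λ i j _ → shift-singleton discrete P i j i (x∈⁅y⁆⇒x≡y i)
    }

  ≼discrete : ∀ P →
    (∀ x → ∃ λ i → x ∈ block P i × (∀ {y} → y ∈ block P i → y ≡ x)) →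
    P ≼ discrete
  ≼discrete P single = record
    { Z⊆     = λ {x} x∈Z →
        contradiction x∈Z (block⊆∉Z P (proj₁ (proj₂ (single x))))
    ; union  = λ x → let i , x∈B , only = single x in
        ⁅ i ⁆ , λ y → mk⇔
          (λ y∈⁅x⁆ → i , x∈⁅x⁆ i , subst (_∈ _) (sym (x∈⁅y⁆⇒x≡y x y∈⁅x⁆)) x∈B)
          (λ { (i′ , i′∈⁅i⁆ , y∈B) → subst (_∈ ⁅ x ⁆)
               (sym (only (subst (λ ι → y ∈ block P ι)
                                 (x∈⁅y⁆⇒x≡y i i′∈⁅i⁆) y∈B)))
               (x∈⁅x⁆ x) })
    ; labels = λ i x B⊆⁅x⁆ →
        shift-singleton P discrete i x x (λ y∈B → x∈⁅y⁆⇒x≡y x (B⊆⁅x⁆ y∈B))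
    }

  zeroBlock : PartialPartition
  zeroBlock = record
    { Z        = ⊤
    ; size     = 0
    ; block    = λ ()
    ; nonempty = λ ()
    ; disjoint = λ { {()} }
    ; covers   = λ x → mk⇔ (λ x∉⊤ → contradiction ∈⊤ x∉⊤) (λ { (() , _) })
    ; label    = λ ()
    }

  ≼zeroBlock : ∀ P → P ≼ zeroBlock
  ≼zeroBlock P = record { Z⊆ = ⊆⊤ ; union = λ () ; labels = λ _ () }

  zeroBlock≼ : ∀ P → (∀ x → x ∈ Z P) → zeroBlock ≼ P
  zeroBlock≼ P Z-full = record
    { Z⊆     = λ _ → Z-full _
    ; union  = λ j → let x , x∈B = nonempty P j in
        contradiction (Z-full x) (block⊆∉Z P x∈B)
    ; labels = λ ()
    }

  zeroBlock⋠discrete : Fin n → ¬ zeroBlock ≼ discrete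
  zeroBlock⋠discrete x le = ∉⊥ (_≼_.Z⊆ le {x} ∈⊤)

  -- For n = 2 every element other than bottom and top has exactly one nonzero block, so these
  -- represent all the points of the line.
  oneBlock : (B : Subset n) → Nonempty B → (Element B → Carrier) →
             PartialPartition
  oneBlock B ne l = record
    { Z        = ∁ B
    ; size     = 1
    ; block    = λ _ → B
    ; nonempty = λ _ → ne
    ; disjoint = λ { {zero} {zero} _ _ → refl }
    ; covers   = λ x → mk⇔ (λ x∉∁B → zero , x∉∁p⇒x∈p x∉∁B)
                           (λ { (_ , x∈B) → x∈p⇒x∉∁p x∈B })
    ; label    = λ _ → l
    }

  zeroBlock⋠oneBlock : ∀ B ne l → ¬ zeroBlock ≼ oneBlock B ne l
  zeroBlock⋠oneBlock B (x , x∈B) l le = x∈p⇒x∉∁p x∈B (_≼_.Z⊆ le ∈⊤)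

  -- The inequality forces the zero block `∁ B` to be empty, so `B` is everything; it would then
  -- have to fit into the singleton of `x` although it contains `y`.
  oneBlock⋠discrete : ∀ {x y} → x ≢ y → ∀ B ne l → ¬ oneBlock B ne l ≼ discrete
  oneBlock⋠discrete {x} {y} x≢y B ne l le = x≢y (sym (x∈⁅y⁆⇒x≡y x
    (block⊆block le {zero} {x} (full x) (x∈⁅x⁆ x) (full y))))
    where
    full : ∀ z → z ∈ B
    full z = x∉∁p⇒x∈p (λ z∈∁B → ∉⊥ (_≼_.Z⊆ le z∈∁B))

  -- Zero blocks grow, which gives `B′ ⊆ B`; a block of the smaller element lies inside any block of
  -- the larger one that it meets, which gives the converse.
  oneBlock-block : ∀ {B ne l B′ ne′ l′} →
                   oneBlock B ne l ≼ oneBlock B′ ne′ l′ → B ≡ B′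
  oneBlock-block {B = B} {B′ = B′} {ne′ = x , x∈B′} le = ⊆-antisym
    (block⊆block le {zero} {zero} (B′⊆B x∈B′) x∈B′) B′⊆B
    where
    B′⊆B : B′ ⊆ B
    B′⊆B = ∁p⊆∁q⇒p⊇q (_≼_.Z⊆ le)

  oneBlock-≃ : ∀ P B ne l i → block P i ≡ B → (∀ {x} → x ∉ B → x ∈ Z P) →
               Shift (oneBlock B ne l) P zero i → oneBlock B ne l ≃ P
  oneBlock-≃ P B ne l i refl outside⇒Z shift = record
    { Z≡      = ⊆-antisym (λ x∈∁B → outside⇒Z (x∈∁p⇒x∉p x∈∁B))
                  (λ x∈Z → x∉p⇒x∈∁p (λ x∈B → block⊆∉Z P x∈B x∈Z))
    ; blocks⊆ = λ _ → i , refl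
    ; blocks⊇ = λ j → zero , sym (cong (block P) (only j))
    ; labels  = λ { zero j _ →
        subst (Shift (oneBlock B ne l) P zero) (sym (only j)) shift }
    }
    where
    -- Another block would have a point outside `B`, hence in the zero block.
    only : ∀ j → j ≡ i
    only j with x , x∈Bⱼ ← nonempty P j | x ∈? block P i
    ... | yes x∈Bᵢ = disjoint P x∈Bⱼ x∈Bᵢ
    ... | no  x∉Bᵢ = contradiction (outside⇒Z x∉Bᵢ) (block⊆∉Z P x∈Bⱼ)

dowling₀-total : ∀ {c ℓ} (G : Group c ℓ) x y → Poset._≤_ (Q 0 G) x y
dowling₀-total G x y = Poset.trans (Q 0 G) (≼discrete x (λ ())) (discrete≼ y)
  where open DowlingLattice G 0

dowling₁-line : ∀ {c ℓ} (G : Group c ℓ) → IsLine 0 (Q 1 G)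
dowling₁-line G = record
  { bottom          = discrete
  ; top             = zeroBlock
  ; point           = λ ()
  ; minimum         = discrete≼
  ; maximum         = ≼zeroBlock
  ; top≰bottom      = zeroBlock⋠discrete zero
  ; point≰bottom    = λ ()
  ; top≰point       = λ ()
  ; point-injective = λ ()
  ; exhaustive      = exhaustive
  }
  where
  open Dowling 1 G
  open PartialPartition
  open DowlingLattice G 1

  exhaustive : ∀ P → P ≼ discrete ⊎ zeroBlock ≼ P ⊎ ∃ λ (i : Fin 0) → _
  exhaustive P with zero ∈? Z P
  ... | yes 0∈Z = inj₂ (inj₁ (zeroBlock≼ P λ { zero → 0∈Z }))
  ... | no  0∉Z = let i , 0∈B = Equivalence.to (covers P zero) 0∉Z in
    inj₁ (≼discrete P λ { zero → i , 0∈B , λ { {zero} _ → refl } })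

dowling₂-line : ∀ {c ℓ} (G : Group c ℓ) {g} → HasCard (Group.setoid G) g →
                IsLine (2 + g) (Q 2 G)
dowling₂-line G {g} card = record
  { bottom          = discrete
  ; top             = zeroBlock
  ; point           = point′
  ; minimum         = discrete≼
  ; maximum         = ≼zeroBlock
  ; top≰bottom      = zeroBlock⋠discrete zero
  ; point≰bottom    = λ
      { zero          → oneBlock⋠discrete 0≢1 _ _ _
      ; (suc zero)    → oneBlock⋠discrete 0≢1 _ _ _
      ; (suc (suc _)) → oneBlock⋠discrete 0≢1 _ _ _ }
  ; top≰point       = λ
      { zero          → zeroBlock⋠oneBlock _ _ _
      ; (suc zero)    → zeroBlock⋠oneBlock _ _ _
      ; (suc (suc _)) → zeroBlock⋠oneBlock _ _ _ }
  ; point-injective = point-injective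
  ; exhaustive      = exhaustive
  }
  where
  open Group G
    using (Carrier; ε; _∙_; _≈_; _\\_; identityˡ; identityʳ; ∙-congˡ; ∙-congʳ)
    renaming (sym to ≈-sym; trans to ≈-trans)
  open GroupProperties G using (\\-leftDividesˡ)
  open Dowling 2 G
  open PartialPartition
  open DowlingLattice G 2
  module Card = Inverse card

  0≢1 : zero {1} ≢ suc zero
  0≢1 ()

  -- A normal form: left multiplication by the inverse of the label at `zero` brings any labelling
  -- of the full block to one with `ε` there. The remaining label is then an invariant, so the group
  -- elements index these points.
  pairLabel : Carrier → Element (⊤ {2}) → Carrier
  pairLabel h (zero     , _) = ε
  pairLabel h (suc zero , _) = h

  point′ : Fin (2 + g) → PartialPartition
  point′ zero          = oneBlock ⁅ suc zero ⁆ (suc zero , x∈⁅x⁆ _) (const ε)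
  point′ (suc zero)    = oneBlock ⁅ zero ⁆ (zero , x∈⁅x⁆ _) (const ε)
  point′ (suc (suc i)) = oneBlock ⊤ (zero , ∈⊤) (pairLabel (Card.to i))

  point-injective : ∀ i j → point′ i ≼ point′ j → i ≡ j
  point-injective zero          zero          _  = refl
  point-injective (suc zero)    (suc zero)    _  = refl
  point-injective (suc (suc i)) (suc (suc j)) le
    with g , eq ← _≼_.labels le zero zero ⊆-refl =
    cong (λ ι → suc (suc ι)) (card-to-injective card (≈-sym
      (≈-trans (eq (suc zero) ∈⊤ ∈⊤) (≈-trans (∙-congʳ g≈ε) (identityˡ _)))))
    where
    -- Both labellings are `ε` at `zero`, so the multiplier relating them is trivial.
    g≈ε : g ≈ ε
    g≈ε = ≈-trans (≈-sym (identityʳ g)) (≈-sym (eq zero ∈⊤ ∈⊤))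
  point-injective zero          (suc zero)    le =
    contradiction (oneBlock-block le) λ ()
  point-injective zero          (suc (suc _)) le =
    contradiction (oneBlock-block le) λ ()
  point-injective (suc zero)    zero          le =
    contradiction (oneBlock-block le) λ ()
  point-injective (suc zero)    (suc (suc _)) le =
    contradiction (oneBlock-block le) λ ()
  point-injective (suc (suc _)) zero          le =
    contradiction (oneBlock-block le) λ ()
  point-injective (suc (suc _)) (suc zero)    le =
    contradiction (oneBlock-block le) λ ()

  exhaustive : ∀ P → P ≼ discrete ⊎ zeroBlock ≼ P ⊎ ∃ λ i → point′ i ≃ P
  exhaustive P with zero ∈? Z P | suc zero ∈? Z P
  ... | yes 0∈Z | yes 1∈Z =
    inj₂ (inj₁ (zeroBlock≼ P λ { zero → 0∈Z ; (suc zero) → 1∈Z }))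
  ... | yes 0∈Z | no 1∉Z
    with i , 1∈B ← Equivalence.to (covers P (suc zero)) 1∉Z =
    inj₂ (inj₂ (zero , oneBlock-≃ P _ _ _ i
      (⊆-antisym
        (λ { {zero} 0∈B → contradiction 0∈Z (block⊆∉Z P 0∈B)
           ; {suc zero} _ → x∈⁅x⁆ _ })
        (λ x∈⁅1⁆ → subst (_∈ _) (sym (x∈⁅y⁆⇒x≡y _ x∈⁅1⁆)) 1∈B))
      (λ { {zero} _ → 0∈Z ; {suc zero} 1∉ → contradiction (x∈⁅x⁆ _) 1∉ })
      (shift-singleton (point′ zero) P zero i (suc zero) (x∈⁅y⁆⇒x≡y _))))
  ... | no 0∉Z | yes 1∈Z
    with i , 0∈B ← Equivalence.to (covers P zero) 0∉Z =
    inj₂ (inj₂ (suc zero , oneBlock-≃ P _ _ _ i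
      (⊆-antisym
        (λ { {zero} _ → x∈⁅x⁆ _
           ; {suc zero} 1∈B → contradiction 1∈Z (block⊆∉Z P 1∈B) })
        (λ x∈⁅0⁆ → subst (_∈ _) (sym (x∈⁅y⁆⇒x≡y _ x∈⁅0⁆)) 0∈B))
      (λ { {suc zero} _ → 1∈Z ; {zero} 0∉ → contradiction (x∈⁅x⁆ _) 0∉ })
      (shift-singleton (point′ (suc zero)) P zero i zero (x∈⁅y⁆⇒x≡y _))))
  ... | no 0∉Z | no 1∉Z
    with i , 0∈B ← Equivalence.to (covers P zero) 0∉Z
       | j , 1∈B ← Equivalence.to (covers P (suc zero)) 1∉Z
    with suc zero ∈? block P i
  ... | yes 1∈Bᵢ = inj₂ (inj₂ (suc (suc κ) , oneBlock-≃ P _ _ _ i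
      (⊆-antisym ⊆⊤ (λ { {zero} _ → 0∈B ; {suc zero} _ → 1∈Bᵢ }))
      (λ x∉⊤ → contradiction ∈⊤ x∉⊤)
      (l₀ , λ { zero p q → helper₀ q ; (suc zero) p q → helper₁ q })))
    where
    l₀ = label P i (zero , 0∈B)
    l₁ = label P i (suc zero , 1∈Bᵢ)
    -- The index is that of `l₀ ⁻¹ ∙ l₁`, so the multiplier `l₀` carries the labels `ε` and
    -- `Card.to κ` to `l₀` and `l₁`.
    κ  = Card.from (l₀ \\ l₁)

    helper₀ : ∀ q → label P i (zero , q) ≈ l₀ ∙ ε
    helper₀ q rewrite []=-irrelevant q 0∈B = ≈-sym (identityʳ _)

    helper₁ : ∀ q → label P i (suc zero , q) ≈ l₀ ∙ Card.to κ
    helper₁ q rewrite []=-irrelevant q 1∈Bᵢ = ≈-sym (≈-trans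
      (∙-congˡ (Card.strictlyInverseˡ _)) (\\-leftDividesˡ l₀ l₁))
  ... | no 1∉Bᵢ = inj₁ (≼discrete P λ
      { zero       → i , 0∈B , λ { {zero} _ → refl
                                 ; {suc zero} 1∈ → contradiction 1∈ 1∉Bᵢ }
      ; (suc zero) → j , 1∈B , λ
          { {zero} 0∈ → contradiction
              (subst (λ ι → suc zero ∈ block P ι) (disjoint P 0∈ 0∈B) 1∈B) 1∉Bᵢ
          ; {suc zero} _ → refl } })

-- Finite subsets and lists

unique-set-length : {xs ys : List X} → Unique xs → Unique ys →
                    xs ∼[ set ] ys → length xs ≡ length ys
unique-set-length uxs uys xs∼ys =
  ↭-length (∼bag⇒↭ (unique∧set⇒bag uxs uys xs∼ys))

unique-map-injective : ∀ (f : X → Y) {xs} → Unique (map f xs) →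
  ∀ {x y} → x List.∈ xs → y List.∈ xs → f x ≡ f y → x ≡ y
unique-map-injective f (_ ∷ _)  (here refl) (here refl) _  = refl
unique-map-injective f (fx ∷ _) (here refl) (there y∈)  eq =
  contradiction eq (All.lookup fx (∈-map⁺ f y∈))
unique-map-injective f (fx ∷ _) (there x∈)  (here refl) eq =
  contradiction (sym eq) (All.lookup fx (∈-map⁺ f x∈))
unique-map-injective f (_ ∷ u)  (there x∈)  (there y∈)  eq =
  unique-map-injective f u x∈ y∈ eq

unique-lookup-injective : {xs : List X} → Unique xs →
                          ∀ i j → lookup xs i ≡ lookup xs j → i ≡ j
unique-lookup-injective (_ ∷ _)  zero    zero    _  = refl
unique-lookup-injective (x≢ ∷ _) zero    (suc j) eq =
  contradiction eq (All.lookup x≢ (∈-lookup j))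
unique-lookup-injective (x≢ ∷ _) (suc i) zero    eq =
  contradiction (sym eq) (All.lookup x≢ (∈-lookup i))
unique-lookup-injective (_ ∷ u)  (suc i) (suc j) eq =
  cong suc (unique-lookup-injective u i j eq)

unique-length-≤ : {xs : List X} → Unique xs →
  (f : ∀ {x} → x List.∈ xs → Fin w) →
  (∀ {x y} (p : x List.∈ xs) (q : y List.∈ xs) → f p ≡ f q → x ≡ y) →
  length xs ≤ w
unique-length-≤ u f f-inj = injective⇒≤ {f = λ i → f (∈-lookup i)}
  (λ eq → unique-lookup-injective u _ _ (f-inj _ _ eq))

-- Punching a missed value `y` out of the codomain would inject `Fin n` into a set with one element
-- fewer.
injective-hits : (f : Fin n → Fin n) → (∀ {i j} → f i ≡ f j → i ≡ j) →
                 ∀ y → ¬ (∀ i → y ≢ f i)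
injective-hits {suc n} f f-inj y y≢f = 1+n≰n (injective⇒≤
  {f = λ i → punchOut (y≢f i)}
  (λ eq → f-inj (punchOut-injective (y≢f _) (y≢f _) eq)))

elements : Subset n → List (Fin n)
elements []            = []
elements (outside ∷ p) = map suc (elements p)
elements (inside  ∷ p) = zero ∷ map suc (elements p)

length-elements : (p : Subset n) → length (elements p) ≡ ∣ p ∣
length-elements []            = refl
length-elements (outside ∷ p) =
  trans (length-map suc (elements p)) (length-elements p)
length-elements (inside  ∷ p) =
  cong suc (trans (length-map suc (elements p)) (length-elements p))

elements-unique : (p : Subset n) → Unique (elements p)
elements-unique []            = []
elements-unique (outside ∷ p) = Unique.map⁺ suc-injective (elements-unique p)
elements-unique (inside  ∷ p) =
  All.tabulate (λ z∈ 0≡z → let _ , _ , eq = ∈-map⁻ suc z∈ in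
    contradiction (trans 0≡z eq) λ ())
  ∷ Unique.map⁺ suc-injective (elements-unique p)

∈-elements⁻ : (p : Subset n) → ∀ {x} → x List.∈ elements p → x ∈ p
∈-elements⁻ (outside ∷ p) x∈ with _ , y∈ , refl ← ∈-map⁻ suc x∈ =
  there (∈-elements⁻ p y∈)
∈-elements⁻ (inside  ∷ p) (here refl) = here
∈-elements⁻ (inside  ∷ p) (there x∈) with _ , y∈ , refl ← ∈-map⁻ suc x∈ =
  there (∈-elements⁻ p y∈)

∣∣≤length : (p : Subset n) (ys : List Y) (f : Element p → Y) →
  (∀ e → f e List.∈ ys) → (∀ {e e′} → f e ≡ f e′ → proj₁ e ≡ proj₁ e′) →
  ∣ p ∣ ≤ length ys
∣∣≤length p ys f f∈ f-inj = ≤-trans (≤-reflexive (sym (length-elements p)))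
  (unique-length-≤ (elements-unique p)
    (λ x∈ → index (f∈ (_ , ∈-elements⁻ p x∈)))
    (λ _ _ eq → f-inj (index-injective (setoid _) (f∈ _) (f∈ _) eq)))

⊆∧≢⇒∣∣< : {p q : Subset n} → p ⊆ q → p ≢ q → ∣ p ∣ < ∣ q ∣
⊆∧≢⇒∣∣< {p = p} {q} p⊆q p≢q with any? (λ x → (x ∈? q) ×-dec ¬? (x ∈? p))
... | yes (x , x∈q , x∉p) = p⊂q⇒∣p∣<∣q∣ (p⊆q , x , x∈q , x∉p)
... | no none = contradiction (⊆-antisym p⊆q q⊆p) p≢q
  where
  q⊆p : q ⊆ p
  q⊆p {x} x∈q with x ∈? p
  ... | yes x∈p = x∈p
  ... | no  x∉p = contradiction (x , x∈q , x∉p) none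

-- Two-element subsets.

pair : Fin n → Fin n → Subset n
pair u v = ⁅ u ⁆ ∪ ⁅ v ⁆

module _ (u v : Fin n) where
  u∈pair : u ∈ pair u v
  u∈pair = x∈p∪q⁺ (inj₁ (x∈⁅x⁆ u))

  v∈pair : v ∈ pair u v
  v∈pair = x∈p∪q⁺ (inj₂ (x∈⁅x⁆ v))

  ∈pair⁻ : ∀ {x} → x ∈ pair u v → x ≡ u ⊎ x ≡ v
  ∈pair⁻ = Sum.map (x∈⁅y⁆⇒x≡y u) (x∈⁅y⁆⇒x≡y v) ∘ x∈p∪q⁻ ⁅ u ⁆ ⁅ v ⁆

  ⁅u⁆≢pair : u ≢ v → ⁅ u ⁆ ≢ pair u v
  ⁅u⁆≢pair u≢v eq = u≢v (sym (x∈⁅y⁆⇒x≡y u (subst (v ∈_) (sym eq) v∈pair)))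

  ⁅u⁆⊆pair : ⁅ u ⁆ ⊆ pair u v
  ⁅u⁆⊆pair = p⊆p∪q ⁅ v ⁆

  ∣pair∣≤2 : ∣ pair u v ∣ ≤ 2
  ∣pair∣≤2 = ∣∣≤length (pair u v) (u ∷ v ∷ []) proj₁
    (λ (_ , e∈) → [ here , (λ eq → there (here eq)) ]′ (∈pair⁻ e∈)) id

  2≤∣pair∣ : u ≢ v → 2 ≤ ∣ pair u v ∣
  2≤∣pair∣ u≢v = subst (_< ∣ pair u v ∣) (∣⁅x⁆∣≡1 u)
    (⊆∧≢⇒∣∣< ⁅u⁆⊆pair (⁅u⁆≢pair u≢v))

pair⊆ : {p : Subset n} {u v : Fin n} → u ∈ p → v ∈ p → pair u v ⊆ p
pair⊆ u∈p v∈p x∈ with ∈pair⁻ _ _ x∈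
... | inj₁ refl = u∈p
... | inj₂ refl = v∈p

⁅⁆⊆ : {p : Subset n} {u : Fin n} → u ∈ p → ⁅ u ⁆ ⊆ p
⁅⁆⊆ {u = u} u∈p x∈ with refl ← x∈⁅y⁆⇒x≡y u x∈ = u∈p

-- The pairs through `zero` come first, then those avoiding it, so that the length follows Pascal's
-- rule.
pairs : ∀ n → List (Subset n)
pairs zero    = []
pairs (suc n) =
  map (λ i → inside ∷ ⁅ i ⁆) (allFin n) ++ map (outside ∷_) (pairs n)

length-pairs : ∀ n → length (pairs n) ≡ n C 2
length-pairs zero    = refl
length-pairs (suc n) = begin
  length (pairs (suc n))
    ≡⟨ length-++ (map _ (allFin n)) ⟩
  length (map (λ i → inside ∷ ⁅ i ⁆) (allFin n)) +
  length (map (outside ∷_) (pairs n))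
    ≡⟨ cong₂ _+_ (trans (length-map _ (allFin n)) (length-tabulate {n = n} id))
                 (trans (length-map _ (pairs n)) (length-pairs n)) ⟩
  n + n C 2
    ≡⟨ cong (_+ n C 2) (nC1≡n n) ⟨
  n C 1 + n C 2
    ≡⟨ nCk+nC[k+1]≡[n+1]C[k+1] n 1 ⟩
  suc n C 2
    ∎
  where open ≡-Reasoning

pairs-unique : ∀ n → Unique (pairs n)
pairs-unique zero    = []
pairs-unique (suc n) = Unique.++⁺
  (Unique.map⁺
    (λ {i} {j} eq → x∈⁅y⁆⇒x≡y j
      (drop-there (subst (suc i ∈_) eq (there (x∈⁅x⁆ i)))))
    (Unique.allFin⁺ n))
  (Unique.map⁺ (λ { refl → refl }) (pairs-unique n))
  (λ (p , q) → let _ , _ , eq = ∈-map⁻ _ p ; _ , _ , eq′ = ∈-map⁻ _ q in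
    contradiction (trans (sym eq) eq′) λ ())

∈-pairs⁻ : ∀ {p : Subset n} → p List.∈ pairs n → ∃₂ λ u v → u ≢ v × p ≡ pair u v
∈-pairs⁻ {suc n} p∈ with ∈-++⁻ (map (λ i → inside ∷ ⁅ i ⁆) (allFin n)) p∈
... | inj₁ p∈ˡ with i , _ , refl ← ∈-map⁻ _ p∈ˡ =
  zero , suc i , (λ ()) , cong (inside ∷_) (sym (∪-identityˡ ⁅ i ⁆))
... | inj₂ p∈ʳ with _ , q∈ , refl ← ∈-map⁻ _ p∈ʳ
  with u , v , u≢v , refl ← ∈-pairs⁻ q∈ =
  suc u , suc v , u≢v ∘ suc-injective , refl

∈-⋃⁻ : ∀ (ps : List (Subset n)) {x} → x ∈ ⋃ ps → ∃ λ p → p List.∈ ps × x ∈ p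
∈-⋃⁻ []       x∈ = contradiction x∈ ∉⊥
∈-⋃⁻ (p ∷ ps) x∈ with x∈p∪q⁻ p (⋃ ps) x∈
... | inj₁ x∈p = p , here refl , x∈p
... | inj₂ x∈ps with q , q∈ , x∈q ← ∈-⋃⁻ ps x∈ps = q , there q∈ , x∈q

-- Transversal matroids of coverings

module Transversal (𝒞 : Covering m) where
  open Covering 𝒞

  Independent : Subset m → Set
  Independent = PartialTransversal 𝒞

  open Matroid Independent using (IsClosed)

  through : Fin m → List (Subset m)
  through u = 𝒞 ⟨ ⁅ u ⁆ ⟩

  meets? : ∀ u → Decidable (λ (A : Subset m) → Nonempty (A ∩ ⁅ u ⁆))
  meets? u A = nonempty? (A ∩ ⁅ u ⁆)

  through-unique : ∀ u → Unique (through u)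
  through-unique u = Unique.filter⁺ (meets? u) unique

  through⁺ : ∀ {u A} → A List.∈ members → u ∈ A → A List.∈ through u
  through⁺ {u} A∈ u∈A = ∈-filter⁺ (meets? u) A∈
    (u , x∈p∩q⁺ (u∈A , x∈⁅x⁆ u))

  through⁻ : ∀ {u A} → A List.∈ through u → A List.∈ members × u ∈ A
  through⁻ {u} {A} A∈ with A∈members , x , x∈A∩u ← ∈-filter⁻ (meets? u) A∈
    with x∈A , x∈⁅u⁆ ← x∈p∩q⁻ A ⁅ u ⁆ x∈A∩u
    with refl ← x∈⁅y⁆⇒x≡y u x∈⁅u⁆ = A∈members , x∈A

  through-nonempty : ∀ u → ∃ λ A → A List.∈ through u
  through-nonempty u
    with A , A∈ , u∈A ← ∈-⋃⁻ members (subst (u ∈_) (sym union) ∈⊤) =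
    A , through⁺ A∈ u∈A

  -- A matching is given as a list of points with assigned sets. The sets are distinct, so equal
  -- sets come from the same entry and hence from the same point; `I` need only lie among the listed
  -- points.
  independent : (ps : List (Fin m × Subset m)) → Unique (map proj₂ ps) →
    All (λ (u , A) → A List.∈ through u) ps → ∀ {I} →
    (∀ {e} → e ∈ I → e List.∈ map proj₁ ps) → Independent I
  independent ps distinct incident {I} matched = record
    { φ         = λ e → proj₂ (proj₁ (partner e))
    ; φ-member  = λ e → proj₁ (through⁻ (valid e))
    ; injective = λ {e} {f} eq → trans (proj₂ (proj₂ (partner e))) (trans
        (cong proj₁ (unique-map-injective proj₂ distinct
          (proj₁ (proj₂ (partner e))) (proj₁ (proj₂ (partner f))) eq))
        (sym (proj₂ (proj₂ (partner f)))))
    ; e∈φe      = λ e → proj₂ (through⁻ (valid e))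
    }
    where
    partner : ∀ (e : Element I) → ∃ λ p → p List.∈ ps × proj₁ e ≡ proj₁ p
    partner (_ , e∈I) = ∈-map⁻ proj₁ (matched e∈I)

    valid : ∀ e → proj₂ (proj₁ (partner e)) List.∈ through (proj₁ e)
    valid e with partner e
    ... | p , p∈ps , eq rewrite eq = All.lookup incident p∈ps

  independent-singleton : ∀ u {I} → (∀ {e} → e ∈ I → e ≡ u) → Independent I
  independent-singleton u I⊆ with A , A∈ ← through-nonempty u =
    independent ((u , A) ∷ []) ([] ∷ []) (A∈ ∷ []) (λ e∈I → here (I⊆ e∈I))

  -- The rank of `A` is at most its size, while the independent set `A ∪ ⁅ z ⁆` has one more
  -- element, so a point outside `A` raises the rank.
  closed : ∀ {A} → (∀ z → z ∉ A → Independent (A ∪ ⁅ z ⁆)) → IsClosed A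
  closed {A} extend z (r , ((I , I⊆A , _ , ∣I∣≡r) , _) , (_ , bound))
    with z ∈? A
  ... | yes z∈A = z∈A
  ... | no  z∉A = contradiction (bound (A ∪ ⁅ z ⁆) id (extend z z∉A)) (<⇒≱
    (≤-<-trans (subst (_≤ ∣ A ∣) ∣I∣≡r (p⊆q⇒∣p∣≤∣q∣ I⊆A))
      (p⊂q⇒∣p∣<∣q∣ (p⊆p∪q ⁅ z ⁆ , z , x∈p∪q⁺ (inj₂ (x∈⁅x⁆ z)) , z∉A))))

  -- `I` attains the rank of both `A` and `A ∪ ⁅ z ⁆`, so `z` lies in the closure of `A`.
  closed-absorbs : ∀ {A z} → IsClosed A →
    (I : Subset m) → I ⊆ A → Independent I →
    (∀ J → J ⊆ A ∪ ⁅ z ⁆ → Independent J → ∣ J ∣ ≤ ∣ I ∣) → z ∈ A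
  closed-absorbs {A} {z} cl I I⊆A ind bound = cl z
    ( ∣ I ∣
    , ((I , I⊆A , ind , refl) , λ J J⊆A → bound J (p⊆p∪q ⁅ z ⁆ ∘ J⊆A))
    , ((I , p⊆p∪q ⁅ z ⁆ ∘ I⊆A , ind , refl) , bound))

  closed-⊥ : IsClosed ⊥
  closed-⊥ = closed λ z _ → independent-singleton z
    (λ e∈ → x∈⁅y⁆⇒x≡y z (subst (_ ∈_) (∪-identityˡ ⁅ z ⁆) e∈))

  closed-⊤ : IsClosed ⊤
  closed-⊤ _ _ = ∈⊤

  -- Every strict step of the chain adds at least one point to the flat.
  chain-≤ : ∀ {F} → Chain (L 𝒞) k F → k ≤ ∣ proj₁ F ∣
  chain-≤ (start _)                = z≤n
  chain-≤ (step chain (F⊆G , F≢G)) =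
    ≤-trans (s≤s (chain-≤ chain)) (⊆∧≢⇒∣∣< F⊆G F≢G)

  ⊥≢⁅_⁆ : ∀ (u : Fin m) → ⊥ ≢ ⁅ u ⁆
  ⊥≢⁅ u ⁆ eq = ∉⊥ (subst (u ∈_) (sym eq) (x∈⁅x⁆ u))

-- Coverings whose transversal matroid is simple.

module Simple (𝒞 : Covering m)
  (simple : ∀ u v → u ≢ v →
    ¬ ((𝒞 ⟨ ⁅ u ⁆ ⟩ ∼[ set ] 𝒞 ⟨ ⁅ v ⁆ ⟩) × length (𝒞 ⟨ ⁅ u ⁆ ⟩) ≡ 1))
  where
  open Transversal 𝒞
  open Matroid Independent using (IsClosed)

  -- If no two different sets can be chosen, every set through `u` equals every set through `v`;
  -- both lists are nonempty, so both consist of one common set, which `simple` forbids.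
  pair-transversal : ∀ {u v} → u ≢ v →
    ∃₂ λ A B → A List.∈ through u × B List.∈ through v × A ≢ B
  pair-transversal {u} {v} u≢v
    with Any.any? (λ A → Any.any? (λ B → ¬? (A ≟ˢ B)) (through v)) (through u)
  ... | yes found with A , A∈ , found′ ← find found
                  with B , B∈ , A≢B ← find found′ = A , B , A∈ , B∈ , A≢B
  ... | no none with S , S∈ ← through-nonempty u | T , T∈ ← through-nonempty v =
    contradiction
      ( (λ {z} → mk⇔
          (λ z∈ → subst (List._∈ through v) (sym (same z∈ T∈)) T∈)
          (λ z∈ → subst (List._∈ through u) (same S∈ z∈) S∈))
      , unique-set-length (through-unique u) ([] ∷ [])
          (λ {z} → mk⇔ (λ z∈ → here (trans (same z∈ T∈) (sym (same S∈ T∈))))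
                       (λ { (here refl) → S∈ })))
      (simple u v u≢v)
    where
    same : ∀ {A B} → A List.∈ through u → B List.∈ through v → A ≡ B
    same {A} {B} A∈ B∈ with A ≟ˢ B
    ... | yes A≡B = A≡B
    ... | no  A≢B = contradiction (lose A∈ (lose B∈ A≢B)) none

  independent-pair : ∀ {u v} → u ≢ v → Independent (pair u v)
  independent-pair {u} {v} u≢v
    with A , B , A∈ , B∈ , A≢B ← pair-transversal u≢v =
    independent ((u , A) ∷ (v , B) ∷ []) ((A≢B ∷ []) ∷ [] ∷ []) (A∈ ∷ B∈ ∷ [])
      (λ e∈ → [ here , (λ eq → there (here eq)) ]′ (∈pair⁻ u v e∈))

  closed-⁅⁆ : ∀ u → IsClosed ⁅ u ⁆
  closed-⁅⁆ u = closed λ z z∉ → independent-pair λ { refl → z∉ (x∈⁅x⁆ u) }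

  pointFlat : Fin m → Poset.Carrier (L 𝒞)
  pointFlat u = ⁅ u ⁆ , closed-⁅⁆ u

  height-point : ∀ u → HasHeight (L 𝒞) (pointFlat u) 1
  height-point u =
    step (start (⊥ , closed-⊥)) (⊥⊆ , ⊥≢⁅ u ⁆) ,
    λ _ chain → subst (_ ≤_) (∣⁅x⁆∣≡1 u) (chain-≤ chain)

  height-pair : ∀ {A u v} → u ≢ v → A ≡ pair u v → (cl : IsClosed A) →
                HasHeight (L 𝒞) (A , cl) 2
  height-pair {u = u} {v} u≢v refl cl =
    step (proj₁ (height-point u)) (⁅u⁆⊆pair u v , ⁅u⁆≢pair u v u≢v) ,
    λ _ chain → ≤-trans (chain-≤ chain) (∣pair∣≤2 u v)

  -- Every pair is then a flat of height 2, and different pairs are different flats. This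
  -- contradicts the strict bound on the number of such flats when `F` has fewer than three points.
  pairs-closed⇒≤ : (∀ {u v} → u ≢ v → IsClosed (pair u v)) →
                   HasCard (AtHeight (L 𝒞) 2) w → m C 2 ≤ w
  pairs-closed⇒≤ pair-closed card = subst (_≤ _) (length-pairs m)
    (unique-length-≤ (pairs-unique m) (λ A∈ → Inverse.from card (flat A∈))
      (λ A∈ B∈ → card-from-injective {S = AtHeight (L 𝒞) 2} card
        {flat A∈} {flat B∈}))
    where
    flat : ∀ {A} → A List.∈ pairs m → ∃ λ F → HasHeight (L 𝒞) F 2
    flat {A} A∈ with u , v , u≢v , eq ← ∈-pairs⁻ A∈ =
      (A , cl) , height-pair u≢v eq cl
      where
      cl : IsClosed A
      cl = subst IsClosed (sym eq) (pair-closed u≢v)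

  -- Phrased as a search through three lists, which makes the existence of a transversal decidable.
  TripleTransversal : Fin m → Fin m → Fin m → Set
  TripleTransversal p q r = Any (λ A → Any (λ B → Any (λ D →
    A ≢ B × A ≢ D × B ≢ D) (through r)) (through q)) (through p)

  independent-triple : ∀ {p q r} → TripleTransversal p q r →
    Independent (pair p q ∪ ⁅ r ⁆)
  independent-triple {p} {q} {r} found
    with A , A∈ , found′ ← find found
    with B , B∈ , found″ ← find found′
    with D , D∈ , A≢B , A≢D , B≢D ← find found″ =
    independent ((p , A) ∷ (q , B) ∷ (r , D) ∷ [])
      ((A≢B ∷ A≢D ∷ []) ∷ (B≢D ∷ []) ∷ [] ∷ []) (A∈ ∷ B∈ ∷ D∈ ∷ [])
      (λ e∈ → [ [ here , (λ eq → there (here eq)) ]′ ∘ ∈pair⁻ p q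
              , (λ e∈r → there (there (here (x∈⁅y⁆⇒x≡y r e∈r)))) ]′
              (x∈p∪q⁻ (pair p q) ⁅ r ⁆ e∈))

  -- Coverings for which `ℰ` consists of a single set `F`.

  module OneLine (F : Subset m)
    (E≡F : ∀ h → length (through h) ≡ 2 → E 𝒞 h ≡ F)
    (x₀ : Fin m) (∣x₀∣≡2 : length (through x₀) ≡ 2)
    where

    ∈E⁺ : ∀ {h y} → (∀ {A} → A List.∈ through y → A List.∈ through h) →
      y ∈ E 𝒞 h
    ∈E⁺ {h} sub = ∈⟦⟧⁺ (λ y → ListSubset._⊆?_ _≟ˢ_ (through y) (through h)) sub

    ∈E⁻ : ∀ {h y} → y ∈ E 𝒞 h → ∀ {A} → A List.∈ through y → A List.∈ through h
    ∈E⁻ {h} = ∈⟦⟧⁻ (λ y → ListSubset._⊆?_ _≟ˢ_ (through y) (through h))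

    NoTransversal : Fin m → Fin m → Fin m → Set
    NoTransversal p q r = ∀ {A B D} → A List.∈ through p → B List.∈ through q →
      D List.∈ through r → A ≢ B → A ≢ D → ¬ B ≢ D

    rotate : ∀ {p q r} → NoTransversal p q r → NoTransversal q r p
    rotate none A∈ B∈ D∈ A≢B A≢D B≢D = none D∈ A∈ B∈ (A≢D ∘ sym) (B≢D ∘ sym) A≢B

    -- A set `D` different from both `A` and `B` would complete a transversal of the triple.
    pinned : ∀ {p q r A B D} → NoTransversal p q r →
      A List.∈ through p → B List.∈ through q → A ≢ B →
      D List.∈ through r → D ≡ A ⊎ D ≡ B
    pinned {A = A} {B} {D} none A∈ B∈ A≢B D∈ with D ≟ˢ A | D ≟ˢ B
    ... | yes D≡A | _       = inj₁ D≡A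
    ... | no _    | yes D≡B = inj₂ D≡B
    ... | no D≢A  | no D≢B  =
      contradiction (D≢B ∘ sym) (none A∈ B∈ D∈ A≢B (D≢A ∘ sym))

    -- By `pinned`, exactly `A` and `B` pass through `h`, so `E 𝒞 h` is `F`. Rotating the triple
    -- shows that the sets through `p` and `q` are also among `A` and `B`.
    hub : ∀ {p q h A B} → NoTransversal p q h →
      A List.∈ through p → B List.∈ through q → A ≢ B →
      A List.∈ through h → B List.∈ through h → p ∈ F × q ∈ F × h ∈ F
    hub {p} {q} {h} {A} {B} none A∈p B∈q A≢B A∈h B∈h =
        inF (pinned (rotate none) B∈q A∈h (A≢B ∘ sym))
      , inF (pinned (rotate (rotate none)) B∈h A∈p (A≢B ∘ sym))
      , subst (h ∈_) h-F (∈E⁺ id)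
      where
      h-F : E 𝒞 h ≡ F
      h-F = E≡F h (unique-set-length (through-unique h) ((A≢B ∷ []) ∷ [] ∷ [])
        (λ {z} → mk⇔
          (λ z∈ → [ here , (λ eq → there (here eq)) ]′
            (pinned none A∈p B∈q A≢B z∈))
          (λ { (here refl) → A∈h ; (there (here refl)) → B∈h })))

      inF : ∀ {y} → (∀ {D} → D List.∈ through y → D ≡ B ⊎ D ≡ A) → y ∈ F
      inF sub = subst (_ ∈_) h-F (∈E⁺ λ D∈ →
        [ (λ { refl → B∈h }) , (λ { refl → A∈h }) ]′ (sub D∈))

    -- Hall's condition fails on {p, q, r} only for the whole triple, so two
    -- sets meet it, and one of the three points lies in both.
    dependent⇒∈F : ∀ {p q r} → p ≢ q → p ≢ r → q ≢ r → NoTransversal p q r →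
      p ∈ F × q ∈ F × r ∈ F
    dependent⇒∈F {p} {q} {r} p≢q p≢r q≢r none
      with A , B , A∈p , B∈q , A≢B ← pair-transversal p≢q
      with A′ , D , A′∈p , D∈r , A′≢D ← pair-transversal p≢r
      with B′ , D′ , B′∈q , D′∈r , B′≢D′ ← pair-transversal q≢r
      with pinned none A∈p B∈q A≢B D∈r | pinned none A∈p B∈q A≢B D′∈r
    ... | inj₁ refl | inj₂ refl = hub none A∈p B∈q A≢B D∈r D′∈r
    ... | inj₂ refl | inj₁ refl = hub none A∈p B∈q A≢B D′∈r D∈r
    -- Here `D` and `D′` are both `A`. The set `A′` through `p` differs from `A`, so it is `B`, and
    -- `p` is the hub. If both are `B` instead, `q` is the hub in the same way.
    ... | inj₁ refl | inj₁ refl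
      with pinned (rotate none) B∈q D∈r (A≢B ∘ sym) A′∈p
    ...   | inj₂ eq   = contradiction eq A′≢D
    ...   | inj₁ refl
      with q∈ , r∈ , p∈ ←
        hub (rotate none) B∈q D∈r (A≢B ∘ sym) A′∈p A∈p =
      p∈ , q∈ , r∈
    dependent⇒∈F {p} {q} {r} p≢q p≢r q≢r none | inj₂ refl | inj₂ refl
      with pinned (rotate (rotate none)) D∈r A∈p (A≢B ∘ sym) B′∈q
    ...   | inj₁ eq   = contradiction eq B′≢D′
    ...   | inj₂ refl
      with r∈ , p∈ , q∈ ←
        hub (rotate (rotate none)) D∈r A∈p (A≢B ∘ sym) B∈q B′∈q =
      p∈ , q∈ , r∈

    triple : ∀ {p q r} → p ≢ q → p ≢ r → q ≢ r →
      Independent (pair p q ∪ ⁅ r ⁆) ⊎ (p ∈ F × q ∈ F × r ∈ F)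
    triple {p} {q} {r} p≢q p≢r q≢r
      with Any.any? (λ A → Any.any? (λ B → Any.any? (λ D →
             ¬? (A ≟ˢ B) ×-dec ¬? (A ≟ˢ D) ×-dec ¬? (B ≟ˢ D))
             (through r)) (through q)) (through p)
    ... | yes found = inj₁ (independent-triple found)
    ... | no none = inj₂ (dependent⇒∈F p≢q p≢r q≢r
      (λ A∈ B∈ D∈ A≢B A≢D B≢D →
        none (lose A∈ (lose B∈ (lose D∈ (A≢B , A≢D , B≢D))))))

    -- The pair extends by `w` to an independent triple unless all three points lie in `F`.
    closed-pair : ∀ {u v} → u ≢ v →
      (∀ w → u ≢ w → v ≢ w → u ∈ F → v ∈ F → ¬ w ∈ F) → IsClosed (pair u v)
    closed-pair {u} {v} u≢v no-third = closed λ w w∉ →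
      let u≢w = λ { refl → w∉ (u∈pair u v) }
          v≢w = λ { refl → w∉ (v∈pair u v) }
      in [ id
           , (λ (u∈F , v∈F , w∈F) →
               contradiction w∈F (no-third w u≢w v≢w u∈F v∈F)) ]′
           (triple u≢v u≢w v≢w)

    -- As `F` is `E 𝒞 x₀`, a transversal of points of `F` uses only the two sets through `x₀`.
    rank-F : ∀ {I} → I ⊆ F → Independent I → ∣ I ∣ ≤ 2
    rank-F {I} I⊆F ind = subst (∣ I ∣ ≤_) ∣x₀∣≡2 (∣∣≤length I (through x₀) φ
      (λ e → ∈E⁻ (subst (proj₁ e ∈_) (sym (E≡F x₀ ∣x₀∣≡2)) (I⊆F (proj₂ e)))
                 (through⁺ (φ-member e) (e∈φe e)))
      injective)
      where open PartialTransversal ind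

    -- The pair of `u` and `v` already attains the largest rank possible inside `F`, so adding a
    -- point of `F` cannot raise the rank of `A`.
    flat-absorbs : ∀ {A u v} → IsClosed A → A ⊆ F →
      u ≢ v → u ∈ A → v ∈ A → F ⊆ A
    flat-absorbs {A} {u} {v} cl A⊆F u≢v u∈A v∈A {w} w∈F =
      closed-absorbs cl (pair u v) (pair⊆ u∈A v∈A) (independent-pair u≢v)
      (λ J J⊆ ind → ≤-trans
        (rank-F (λ j∈ → [ A⊆F , ⁅⁆⊆ w∈F ]′ (x∈p∪q⁻ A ⁅ w ⁆ (J⊆ j∈))) ind)
        (2≤∣pair∣ u v u≢v))

    closed-pair-∉ : ∀ {u v} → u ≢ v → u ∉ F ⊎ v ∉ F → IsClosed (pair u v)
    closed-pair-∉ u≢v (inj₁ u∉F) = closed-pair u≢v λ _ _ _ u∈F _ _ → u∉F u∈F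
    closed-pair-∉ u≢v (inj₂ v∉F) = closed-pair u≢v λ _ _ _ _ v∈F _ → v∉F v∈F

    -- The pair is itself a flat because `z` is outside `F`, and it lies above `⁅ u ⁆` and within
    -- the cover.
    cover-∉ : ∀ {u z A} → _⋖_ (L 𝒞) (pointFlat u) A → z ∈ proj₁ A →
              u ≢ z → z ∉ F → proj₁ A ≡ pair u z
    cover-∉ {u} {z} {A} ((⁅u⁆⊆A , _) , adjacent) z∈A u≢z z∉F
      with pair u z ≟ˢ proj₁ A
    ... | yes eq  = sym eq
    ... | no  neq = ⊥-elim (adjacent (pair u z , closed-pair-∉ u≢z (inj₂ z∉F))
      ( (⁅u⁆⊆pair u z , ⁅u⁆≢pair u z u≢z)
      , (pair⊆ (⁅u⁆⊆A (x∈⁅x⁆ u)) z∈A , neq)))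

    -- A point `t` of `A` outside `F` would force `A` to be `pair u t`, with no room for `z`. Hence
    -- `A ⊆ F`, and two points of `A` absorb the rest of `F`.
    cover-∈ : ∀ {u z A} → _⋖_ (L 𝒞) (pointFlat u) A → z ∈ proj₁ A →
              u ≢ z → u ∈ F → z ∈ F → proj₁ A ≡ F
    cover-∈ {u} {z} {A} cover@((⁅u⁆⊆A , _) , _) z∈A u≢z u∈F z∈F =
      ⊆-antisym A⊆F (flat-absorbs (proj₂ A) A⊆F u≢z (⁅u⁆⊆A (x∈⁅x⁆ u)) z∈A)
      where
      A⊆F : proj₁ A ⊆ F
      A⊆F {t} t∈A with t ∈? F
      ... | yes t∈F = t∈F
      ... | no  t∉F
        with ∈pair⁻ u t (subst (z ∈_)
          (cover-∉ {A = A} cover t∈A (λ { refl → t∉F u∈F }) t∉F) z∈A)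
      ...   | inj₁ z≡u = contradiction (sym z≡u) u≢z
      ...   | inj₂ refl = z∈F

    pair-⋖ : ∀ {u v} (u≢v : u ≢ v) (u∉F : u ∉ F) →
             _⋖_ (L 𝒞) (pointFlat u) (pair u v , closed-pair-∉ u≢v (inj₁ u∉F))
    pair-⋖ {u} {v} u≢v u∉F =
      (⁅u⁆⊆pair u v , ⁅u⁆≢pair u v u≢v) ,
      -- A flat strictly between would have a size strictly between 1 and 2.
      λ (A , _) ((⁅u⁆⊆A , ⁅u⁆≢A) , (A⊆pair , A≢pair)) → <⇒≱
        (≤-<-trans (subst (_< ∣ A ∣) (∣⁅x⁆∣≡1 u) (⊆∧≢⇒∣∣< ⁅u⁆⊆A ⁅u⁆≢A))
                   (⊆∧≢⇒∣∣< A⊆pair A≢pair))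
        (∣pair∣≤2 u v)

    -- Three points on `F`: the uniformity argument and the resulting line.

    module LongLine {a b c} (a≢b : a ≢ b) (a≢c : a ≢ c) (b≢c : b ≢ c)
                    (a∈F : a ∈ F) (b∈F : b ∈ F) (c∈F : c ∈ F) where

      -- A cover of {a} is determined by any of its other points; c is avoided
      -- because b already represents F.
      representative : ∀ A → _⋖_ (L 𝒞) (pointFlat a) A → ∃ λ z →
        a ≢ z × c ≢ z × (z ∈ F → proj₁ A ≡ F) × (z ∉ F → proj₁ A ≡ pair a z)
      representative A cover@((⁅a⁆⊆A , ⁅a⁆≢A) , _)
        with any? (λ z → (z ∈? proj₁ A) ×-dec ¬? (a ≟ᶠ z))
      ... | no none = contradiction (⊆-antisym ⁅a⁆⊆A A⊆⁅a⁆) ⁅a⁆≢A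
        where
        A⊆⁅a⁆ : proj₁ A ⊆ ⁅ a ⁆
        A⊆⁅a⁆ {z} z∈A with a ≟ᶠ z
        ... | yes refl = x∈⁅x⁆ a
        ... | no a≢z   = contradiction (z , z∈A , a≢z) none
      ... | yes (z , z∈A , a≢z) with c ≟ᶠ z
      ...   | yes refl = b , a≢b , b≢c ∘ sym ,
        (λ _ → cover-∈ {A = A} cover z∈A a≢z a∈F c∈F) ,
        (λ b∉F → contradiction b∈F b∉F)
      ...   | no c≢z = z , a≢z , c≢z ,
        cover-∈ {A = A} cover z∈A a≢z a∈F , cover-∉ {A = A} cover z∈A a≢z

      representative-injective : ∀ {A B} p q →
        proj₁ (representative A p) ≡ proj₁ (representative B q) →
        proj₁ A ≡ proj₁ B
      representative-injective {A} {B} p q eq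
        with representative A p | representative B q
      ... | z , _ , _ , A≡F , A≡pair | _ , _ , _ , B≡F , B≡pair
        with refl ← eq | z ∈? F
      ...   | yes z∈F = trans (A≡F z∈F) (sym (B≡F z∈F))
      ...   | no  z∉F = trans (A≡pair z∉F) (sym (B≡pair z∉F))

      -- Each `v` other than `y` gives the cover `pair y v` of `y`. Equal cover counts carry these
      -- injectively to covers of `a`, whose representatives avoid `a` and `c`. Sending `y` to `a`
      -- completes an injective self-map of `Fin m` that misses `c`.
      ¬uniform : ∀ {y} → y ∉ F → ¬ Uniform (L 𝒞)
      ¬uniform {y} y∉F uniform
        with k , card-a , card-y ← uniform (pointFlat a) (pointFlat y) 1
               (height-point a) (height-point y) =
        injective-hits f f-injective c c≢f
        where
        line : ∀ {v} → y ≢ v → ∃ (_⋖_ (L 𝒞) (pointFlat y))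
        line {v} y≢v =
          (pair y v , closed-pair-∉ y≢v (inj₁ y∉F)) , pair-⋖ y≢v y∉F

        cover : ∀ {v} → y ≢ v → ∃ (_⋖_ (L 𝒞) (pointFlat a))
        cover y≢v = Inverse.to card-a (Inverse.from card-y (line y≢v))

        rep : ∀ {v} (y≢v : y ≢ v) → _
        rep y≢v = representative (proj₁ (cover y≢v)) (proj₂ (cover y≢v))

        f′ : ∀ v → Dec (y ≡ v) → Fin m
        f′ v (yes _)  = a
        f′ v (no y≢v) = proj₁ (rep y≢v)

        f : Fin m → Fin m
        f v = f′ v (y ≟ᶠ v)

        f′-injective : ∀ {v w} p q → f′ v p ≡ f′ w q → v ≡ w
        f′-injective (yes refl) (yes refl) _  = refl
        f′-injective (yes _)    (no y≢w)   eq =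
          contradiction eq (proj₁ (proj₂ (rep y≢w)))
        f′-injective (no y≢v)   (yes _)    eq =
          contradiction (sym eq) (proj₁ (proj₂ (rep y≢v)))
        f′-injective {v} {w} (no y≢v) (no y≢w) eq
          with ∈pair⁻ y w (subst (v ∈_) same (v∈pair y v))
          where
          same : pair y v ≡ pair y w
          same = card-from-injective {S = Covers (L 𝒞) (pointFlat y)} card-y
            {line y≢v} {line y≢w}
            (card-to-injective {S = Covers (L 𝒞) (pointFlat a)} card-a
              (representative-injective
                {proj₁ (cover y≢v)} {proj₁ (cover y≢w)} _ _ eq))
        ... | inj₁ v≡y = contradiction (sym v≡y) y≢v
        ... | inj₂ v≡w = v≡w

        f-injective : ∀ {v w} → f v ≡ f w → v ≡ w
        f-injective {v} {w} = f′-injective (y ≟ᶠ v) (y ≟ᶠ w)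

        c≢f : ∀ v → c ≢ f v
        c≢f v with y ≟ᶠ v
        ... | yes _  = a≢c ∘ sym
        ... | no y≢v = proj₁ (proj₂ (proj₂ (rep y≢v)))

      isLine : (∀ u → u ∈ F) → IsLine m (L 𝒞)
      isLine full = record
        { bottom          = ⊥ , closed-⊥
        ; top             = ⊤ , closed-⊤
        ; point           = pointFlat
        ; minimum         = λ _ → ⊥⊆
        ; maximum         = λ _ → ⊆⊤
        ; top≰bottom      = λ ⊤⊆⊥ → ∉⊥ (⊤⊆⊥ {a} ∈⊤)
        ; point≰bottom    = λ u ⁅u⁆⊆⊥ → ∉⊥ (⁅u⁆⊆⊥ (x∈⁅x⁆ u))
        ; top≰point       = λ u ⊤⊆⁅u⁆ → a≢b
            (trans (x∈⁅y⁆⇒x≡y u (⊤⊆⁅u⁆ ∈⊤)) (sym (x∈⁅y⁆⇒x≡y u (⊤⊆⁅u⁆ ∈⊤))))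
        ; point-injective = λ u v ⁅u⁆⊆⁅v⁆ → x∈⁅y⁆⇒x≡y v (⁅u⁆⊆⁅v⁆ (x∈⁅x⁆ u))
        ; exhaustive      = exhaustive
        }
        where
        exhaustive : ∀ A → proj₁ A ⊆ ⊥ ⊎ ⊤ ⊆ proj₁ A ⊎ ∃ λ u → ⁅ u ⁆ ≡ proj₁ A
        exhaustive (A , cl) with nonempty? A
        ... | no empty = inj₁ (λ {x} x∈A → contradiction (x , x∈A) empty)
        ... | yes (u , u∈A) with any? (λ v → (v ∈? A) ×-dec ¬? (u ≟ᶠ v))
        -- Here `F` is the whole ground set, so a flat with two points absorbs everything.
        ...   | yes (v , v∈A , u≢v) =
          inj₂ (inj₁ λ _ → flat-absorbs cl (λ _ → full _) u≢v u∈A v∈A (full _))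
        ...   | no none = inj₂ (inj₂ (u , ⊆-antisym (⁅⁆⊆ u∈A) A⊆⁅u⁆))
          where
          A⊆⁅u⁆ : A ⊆ ⁅ u ⁆
          A⊆⁅u⁆ {v} v∈A with u ≟ᶠ v
          ... | yes refl = x∈⁅x⁆ u
          ... | no u≢v   = contradiction (v , v∈A , u≢v) none

    line : Uniform (L 𝒞) → HasCard (AtHeight (L 𝒞) 2) w → w < m C 2 →
           IsLine m (L 𝒞)
    line uniform card w<mC2
      with any? (λ a → any? λ b → any? λ c →
             (¬? (a ≟ᶠ b) ×-dec ¬? (a ≟ᶠ c) ×-dec ¬? (b ≟ᶠ c)) ×-dec
             (a ∈? F) ×-dec (b ∈? F) ×-dec (c ∈? F))
    -- Without three points on `F`, the condition of `closed-pair` holds for every pair.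
    ... | no none = contradiction
      (pairs-closed⇒≤ (λ {u} {v} u≢v → closed-pair u≢v λ w u≢w v≢w u∈F v∈F w∈F →
        none (u , v , w , (u≢v , u≢w , v≢w) , u∈F , v∈F , w∈F)) card)
      (<⇒≱ w<mC2)
    ... | yes (a , b , c , (a≢b , a≢c , b≢c) , a∈F , b∈F , c∈F)
      with any? (λ y → ¬? (y ∈? F))
    ...   | yes (y , y∉F) = contradiction uniform
      (LongLine.¬uniform a≢b a≢c b≢c a∈F b∈F c∈F y∉F)
    ...   | no none = LongLine.isLine a≢b a≢c b≢c a∈F b∈F c∈F full
      where
      full : ∀ u → u ∈ F
      full u with u ∈? F
      ... | yes u∈F = u∈F
      ... | no  u∉F = contradiction (u , u∉F) none

-- The hypothesis k = 1, the coverings for n = 0 and n = 1, and the conclusion.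

module _ (𝒞 : Covering m) where
  -- All sets `E 𝒞 x` of points in exactly two sets land in the one-entry list, so they agree; that
  -- entry comes from such a point, so one exists.
  length-ℰ≡1⁻ : length (ℰ 𝒞) ≡ 1 → ∃ λ F →
    (∀ x → length (𝒞 ⟨ ⁅ x ⁆ ⟩) ≡ 2 → E 𝒞 x ≡ F) ×
    ∃ λ x → length (𝒞 ⟨ ⁅ x ⁆ ⟩) ≡ 2
  length-ℰ≡1⁻ one with ℰ 𝒞 in eq
  length-ℰ≡1⁻ _ | F ∷ [] = F , E≡F , x₀
    where
    double? : ∀ x → Dec (length (𝒞 ⟨ ⁅ x ⁆ ⟩) ≡ 2)
    double? x = length (𝒞 ⟨ ⁅ x ⁆ ⟩) ≟ⁿ 2

    E≡F : ∀ x → length (𝒞 ⟨ ⁅ x ⁆ ⟩) ≡ 2 → E 𝒞 x ≡ F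
    E≡F x double with here E≡F ← subst (E 𝒞 x List.∈_) eq
      (∈-deduplicate⁺ _≟ˢ_
        (∈-map⁺ (E 𝒞) (∈-filter⁺ double? (∈-allFin x) double))) = E≡F

    x₀ : ∃ λ x → length (𝒞 ⟨ ⁅ x ⁆ ⟩) ≡ 2
    x₀ with x , x∈ , _ ← ∈-map⁻ (E 𝒞) (∈-deduplicate⁻ _≟ˢ_
      (map (E 𝒞) (filter double? (allFin m)))
      (subst (F List.∈_) (sym eq) (here refl))) =
      x , proj₂ (∈-filter⁻ double? {xs = allFin m} x∈)

emptyCovering : Covering 0
emptyCovering = record { members = [] ; unique = [] ; union = refl }

-- Its only flats are the empty set and the whole ground set, matching the two-element chain
-- `Q 1 G`.
pointCovering : Covering 1
pointCovering = record { members = ⊤ ∷ [] ; unique = [] ∷ [] ; union = refl }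

pointCovering-line : IsLine 0 (L pointCovering)
pointCovering-line = record
  { bottom          = ⊥ , closed-⊥
  ; top             = ⊤ , closed-⊤
  ; point           = λ ()
  ; minimum         = λ _ → ⊥⊆
  ; maximum         = λ _ → ⊆⊤
  ; top≰bottom      = λ ⊤⊆⊥ → ∉⊥ {x = zero} (⊤⊆⊥ ∈⊤)
  ; point≰bottom    = λ ()
  ; top≰point       = λ ()
  ; point-injective = λ ()
  ; exhaustive      = λ
      { (outside ∷ [] , _) → inj₁ id ; (inside ∷ [] , _) → inj₂ (inj₁ id) }
  }
  where open Transversal pointCovering

theorem4p16 : ∀ {c ℓ} (G : Group c ℓ) (g : ℕ) → HasCard (Group.setoid G) g →
    (∀ n → n ≡ 0 ⊎ n ≡ 1 → ∃ λ m → ∃ λ (𝒞 : Covering m) → L 𝒞 ≅ Q n G)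
    ×
    (∀ m (𝒞 : Covering m) →
    (∀ u v → u ≢ v →
    ¬ ((𝒞 ⟨ ⁅ u ⁆ ⟩ ∼[ set ] 𝒞 ⟨ ⁅ v ⁆ ⟩) × length (𝒞 ⟨ ⁅ u ⁆ ⟩) ≡ 1)) →
    Uniform (L 𝒞) →
    (∃ λ w → HasCard (AtHeight (L 𝒞) 2) w × w < m C 2) →
    m ≡ g + 2 → length (ℰ 𝒞) ≡ 1 → L 𝒞 ≅ Q 2 G)
theorem4p16 G g card =
  (λ { _ (inj₁ refl) → 0 , emptyCovering ,
         singletons-≅ {P = L emptyCovering} {Q = Q 0 G}
         (⊥ , λ ()) (DowlingLattice.discrete G 0)
         (λ { ([] , _) ([] , _) → id }) (dowling₀-total G)
     ; _ (inj₂ refl) → 1 , pointCovering ,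
         lines-≅ pointCovering-line (dowling₁-line G) }) ,
  λ m 𝒞 simple uniform (w , card₂ , w<mC2) m≡g+2 one →
    let F , E≡F , x₀ , double = length-ℰ≡1⁻ 𝒞 one in
    lines-≅ (Simple.OneLine.line 𝒞 simple F E≡F x₀ double uniform card₂ w<mC2)
      (subst (λ k → IsLine k (Q 2 G)) (trans (+-comm 2 g) (sym m≡g+2))
        (dowling₂-line G card))
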